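{- Let $V=\{v_1,\dots,v_m\}\subset\mathbb{R}^n/\mathbb{R}\mathbf 1$ and $\Lambda\in[0,1]^m$. For any $x^0\in C$, where $C$ is a closed, bounded cell of $\mathscr{C}(V,\Lambda)$, there exist weights $w'\in\mathbb{R}^m_{\ge0}$, $w'\ne\mathbf 0$, and biases $\Lambda'\in[0,1]^m$ such that $x^0\in\mathrm{TFW}(V,\Lambda',w')^*$.
   Context: $\mathbb{R}^n/\mathbb{R}\mathbf 1$ is the tropical projective torus (vectors modulo adding a multiple of $\mathbf 1=(1,\dots,1)$). For $x,y\in\mathbb{R}^n/\mathbb{R}\mathbf 1$ and $\lambda\in[0,1]$, $$\mathrm{d}_{\mathrm{tr}}^\lambda(x,y)=\lambda n\max_j(x_j-y_j)-(1-\lambda)n\min_j(x_j-y_j)+(1-2\lambda)\sum_j(x_j-y_j).$$ For weights $w\in\mathbb{R}^m_{\ge0}$ and biases $\Lambda=(\lambda_1,\dots,\lambda_m)\in[0,1]^m$, $\mathrm{TFW}(V,\Lambda,w)^*$ denotes the set of minimizers over $x\in\mathbb{R}^n/\mathbb{R}\mathbf 1$ of $\sum_{i=1}^m w_i\,\mathrm{d}_{\mathrm{tr}}^{\lambda_i}(x,v_i)$. Sectors: for $v\in\mathbb{R}^n$ and $j\in[n]$, the closed max-plus and min-plus sectors with apex $v$ are $S_j^{\max}(-v)=\{x\in\mathbb{R}^n: x_j-v_j\ge x_k-v_k\ \forall k\in[n]\}$ and $S_j^{\min}(-v)=\{x\in\mathbb{R}^n: x_j-v_j\le x_k-v_k\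 \forall k\in[n]\}$. Cellular decomposition: for $\lambda\in[0,1]$ let $\mathcal{N}_\lambda$ be the complete fan in $\mathbb{R}^n$ (each cone invariant under translation by $\mathbb{R}\mathbf 1$) whose maximal cones are: the full-dimensional intersections $S_j^{\max}(\mathbf 0)\cap S_k^{\min}(\mathbf 0)$, $j\ne k$, if $0<\lambda<1$; the sectors $S_j^{\max}(\mathbf 0)$ if $\lambda=0$; the sectors $S_j^{\min}(\mathbf 0)$ if $\lambda=1$. (This is the normal fan of the polar of the unit ball of the gauge $\gamma^\lambda_{\mathrm{tr}}(x)=\mathrm{d}^\lambda_{\mathrm{tr}}(\mathbf 0,x)$.) $\mathscr{C}(V,\Lambda)$ is the common refinement of the translated fans $v_i+\mathcal{N}_{\lambda_i}$, $i\in[m]$; its cells are the nonempty intersections $\bigcap_{i=1}^m(v_i+\sigma_i)$ with $\sigma_i$ a cone of $\mathcal{N}_{\lambda_i}$. A cell is called bounded if its image in $\mathbb{R}^n/\mathbb{R}\mathbf 1\cong\mathbb{R}^{n-1}$ is bounded. -}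

module Defs where

open import Data.Fin using (Fin; zero; suc)
open import Data.Fin.Subset using (Subset; _∈_)
open import Data.Integer using (+_)
open import Data.Nat as ℕ using (ℕ; zero; suc)
import Data.Nat.Properties as ℕ
open import Data.Product using (∃; _×_; _,_)
open import Data.Rational as ℚ using (ℚ; 0ℚ; 1ℚ; ½)
import Data.Rational.Properties as ℚ
open import Data.Rational.Solver using (module +-*-Solver)
open import Data.Sum using (inj₁; inj₂)
open import Data.Vec.Functional using (Vector; tail)
open import Level using (0ℓ)
open import Relation.Binary.Bundles using (Setoid)
open import Relation.Binary.PropositionalEquality using (_≡_; _≢_; refl; sym; trans; cong; cong₂; subst)
open import Relation.Unary using (Pred)

∣p∣≤q : ∀ {p q} → p ℚ.≤ q → ℚ.- p ℚ.≤ q → ℚ.∣ p ∣ ℚ.≤ q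
∣p∣≤q {p} p≤q -p≤q with ℚ.∣p∣≡p∨∣p∣≡-p p
... | inj₁ e = ℚ.≤-trans (ℚ.≤-reflexive e) p≤q
... | inj₂ e = ℚ.≤-trans (ℚ.≤-reflexive e) -p≤q

0≤∣p∣ : ∀ p → 0ℚ ℚ.≤ ℚ.∣ p ∣
0≤∣p∣ p = ℚ.nonNegative⁻¹ ℚ.∣ p ∣ {{ℚ.∣-∣-nonNeg p}}

p≤∣p∣ : ∀ p → p ℚ.≤ ℚ.∣ p ∣
p≤∣p∣ p with ℚ.≤-total 0ℚ p
... | inj₁ 0≤p = ℚ.≤-reflexive (sym (ℚ.0≤p⇒∣p∣≡p 0≤p))
... | inj₂ p≤0 = ℚ.≤-trans p≤0 (0≤∣p∣ p)

∣p-q∣≡∣q-p∣ : ∀ p q → ℚ.∣ p ℚ.- q ∣ ≡ ℚ.∣ q ℚ.- p ∣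
∣p-q∣≡∣q-p∣ p q = trans (cong ℚ.∣_∣ (lemma p q)) (ℚ.∣-p∣≡∣p∣ (q ℚ.- p))
  where
  open +-*-Solver
  lemma : ∀ p q → p ℚ.- q ≡ ℚ.- (q ℚ.- p)
  lemma = solve 2 (λ p q → p :- q := :- (q :- p)) refl

close⇒≤ : ∀ p q {e} → ℚ.∣ p ℚ.- q ∣ ℚ.≤ e → p ℚ.≤ q ℚ.+ e
close⇒≤ p q {e} h = begin
  p                ≡⟨ solve 2 (λ p q → p := q :+ (p :- q)) refl p q ⟩
  q ℚ.+ (p ℚ.- q)  ≤⟨ ℚ.+-monoʳ-≤ q (ℚ.≤-trans (p≤∣p∣ (p ℚ.- q)) h) ⟩
  q ℚ.+ e          ∎
  where
  open ℚ.≤-Reasoning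
  open +-*-Solver

≤⇒-≤ : ∀ p q {e} → p ℚ.≤ q ℚ.+ e → p ℚ.- q ℚ.≤ e
≤⇒-≤ p q {e} h = begin
  p ℚ.- q          ≤⟨ ℚ.+-monoˡ-≤ (ℚ.- q) h ⟩
  q ℚ.+ e ℚ.- q    ≡⟨ solve 2 (λ q e → q :+ e :- q := e) refl q e ⟩
  e                ∎
  where
  open ℚ.≤-Reasoning
  open +-*-Solver

≤⇒close : ∀ p q {e} → p ℚ.≤ q ℚ.+ e → q ℚ.≤ p ℚ.+ e → ℚ.∣ p ℚ.- q ∣ ℚ.≤ e
≤⇒close p q h k = ∣p∣≤q (≤⇒-≤ p q h) (ℚ.≤-trans (ℚ.≤-reflexive lemma) (≤⇒-≤ q p k))
  where
  open +-*-Solver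
  lemma : ℚ.- (p ℚ.- q) ≡ q ℚ.- p
  lemma = solve 2 (λ p q → :- (p :- q) := q :- p) refl p q

flip-close : ∀ p q {e} → ℚ.∣ p ℚ.- q ∣ ℚ.≤ e → ℚ.∣ q ℚ.- p ∣ ℚ.≤ e
flip-close p q = ℚ.≤-trans (ℚ.≤-reflexive (∣p-q∣≡∣q-p∣ q p))

+-close : ∀ a b c d → ℚ.∣ (a ℚ.+ b) ℚ.- (c ℚ.+ d) ∣ ℚ.≤ ℚ.∣ a ℚ.- c ∣ ℚ.+ ℚ.∣ b ℚ.- d ∣
+-close a b c d = begin
  ℚ.∣ (a ℚ.+ b) ℚ.- (c ℚ.+ d) ∣      ≡⟨ cong ℚ.∣_∣ (solve 4 (λ a b c d → (a :+ b) :- (c :+ d) := (a :- c) :+ (b :- d)) refl a b c d) ⟩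
  ℚ.∣ (a ℚ.- c) ℚ.+ (b ℚ.- d) ∣      ≤⟨ ℚ.∣p+q∣≤∣p∣+∣q∣ (a ℚ.- c) (b ℚ.- d) ⟩
  ℚ.∣ a ℚ.- c ∣ ℚ.+ ℚ.∣ b ℚ.- d ∣    ∎
  where
  open ℚ.≤-Reasoning
  open +-*-Solver

neg-close : ∀ a b → ℚ.∣ ℚ.- a ℚ.- (ℚ.- b) ∣ ≡ ℚ.∣ a ℚ.- b ∣
neg-close a b = trans (cong ℚ.∣_∣ (solve 2 (λ a b → :- a :- (:- b) := :- (a :- b)) refl a b)) (ℚ.∣-p∣≡∣p∣ (a ℚ.- b))
  where
  open +-*-Solver

⊔-close : ∀ a b c d {e} → ℚ.∣ a ℚ.- c ∣ ℚ.≤ e → ℚ.∣ b ℚ.- d ∣ ℚ.≤ e → ℚ.∣ (a ℚ.⊔ b) ℚ.- (c ℚ.⊔ d) ∣ ℚ.≤ e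
⊔-close a b c d ac bd = ≤⇒close (a ℚ.⊔ b) (c ℚ.⊔ d) (half a b c d ac bd) (half c d a b (flip-close a c ac) (flip-close b d bd))
  where
  half : ∀ a b c d {e} → ℚ.∣ a ℚ.- c ∣ ℚ.≤ e → ℚ.∣ b ℚ.- d ∣ ℚ.≤ e → a ℚ.⊔ b ℚ.≤ (c ℚ.⊔ d) ℚ.+ e
  half a b c d {e} ac bd = ℚ.⊔-lub
    (ℚ.≤-trans (close⇒≤ a c ac) (ℚ.+-monoˡ-≤ e (ℚ.p≤p⊔q c d)))
    (ℚ.≤-trans (close⇒≤ b d bd) (ℚ.+-monoˡ-≤ e (ℚ.p≤q⊔p c d)))

⊓-close : ∀ a b c d {e} → ℚ.∣ a ℚ.- c ∣ ℚ.≤ e → ℚ.∣ b ℚ.- d ∣ ℚ.≤ e → ℚ.∣ (a ℚ.⊓ b) ℚ.- (c ℚ.⊓ d) ∣ ℚ.≤ e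
⊓-close a b c d ac bd = ≤⇒close (a ℚ.⊓ b) (c ℚ.⊓ d) (half a b c d ac bd) (half c d a b (flip-close a c ac) (flip-close b d bd))
  where
  half : ∀ a b c d {e} → ℚ.∣ a ℚ.- c ∣ ℚ.≤ e → ℚ.∣ b ℚ.- d ∣ ℚ.≤ e → a ℚ.⊓ b ℚ.≤ (c ℚ.⊓ d) ℚ.+ e
  half a b c d {e} ac bd = ℚ.≤-trans
    (ℚ.⊓-glb (ℚ.≤-trans (ℚ.p⊓q≤p a b) (close⇒≤ a c ac)) (ℚ.≤-trans (ℚ.p⊓q≤q a b) (close⇒≤ b d bd)))
    (ℚ.≤-reflexive (sym (ℚ.mono-≤-distrib-⊓ (ℚ.+-monoˡ-≤ e) c d)))

0<½*ε : ∀ {ε} → 0ℚ ℚ.< ε → 0ℚ ℚ.< ½ ℚ.* ε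
0<½*ε {ε} 0<ε = subst (ℚ._< ½ ℚ.* ε) (ℚ.*-zeroʳ ½) (ℚ.*-monoʳ-<-pos ½ 0<ε)

halves : ∀ ε → ½ ℚ.* ε ℚ.+ ½ ℚ.* ε ≡ ε
halves = solve 1 (λ ε → con ½ :* ε :+ con ½ :* ε := ε) refl
  where
  open +-*-Solver

*-mono : ∀ {p q r s} → 0ℚ ℚ.≤ p → 0ℚ ℚ.≤ s → p ℚ.≤ q → r ℚ.≤ s → p ℚ.* r ℚ.≤ q ℚ.* s
*-mono {p} {q} {r} {s} 0≤p 0≤s p≤q r≤s = ℚ.≤-trans
  (ℚ.*-monoˡ-≤-nonNeg p {{ℚ.nonNegative 0≤p}} r≤s)
  (ℚ.*-monoʳ-≤-nonNeg s {{ℚ.nonNegative 0≤s}} p≤q)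

-- Real numbers: Cauchy sequences of rationals (with modulus), compared
-- with the equality _≃_ below rather than with _≡_

Eventually : Pred (Pred ℕ 0ℓ) 0ℓ
Eventually P = ∃ λ N → ∀ n → N ℕ.≤ n → P n

record ℝ : Set where
  constructor mkℝ
  field
    seq    : ℕ → ℚ
    cauchy : ∀ ε → 0ℚ ℚ.< ε →
             ∃ λ N → ∀ m n → N ℕ.≤ m → N ℕ.≤ n → ℚ.∣ seq m ℚ.- seq n ∣ ℚ.≤ ε

open ℝ public

infix 4 _≃_ _≤_ _<_
infix 8 -_
infixl 7 _*_ _⊓_
infixl 6 _+_ _-_ _⊔_

_≃_ _≤_ _<_ : ℝ → ℝ → Set
x ≃ y = ∀ ε → 0ℚ ℚ.< ε → Eventually λ n → ℚ.∣ seq x n ℚ.- seq y n ∣ ℚ.≤ ε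
x ≤ y = ∀ ε → 0ℚ ℚ.< ε → Eventually λ n → seq x n ℚ.≤ seq y n ℚ.+ ε
x < y = ∃ λ ε → 0ℚ ℚ.< ε × Eventually λ n → seq x n ℚ.+ ε ℚ.≤ seq y n

fromℚ : ℚ → ℝ
fromℚ q .seq    = λ _ → q
fromℚ q .cauchy = λ ε 0<ε → 0 , λ _ _ _ _ →
  ℚ.≤-trans (ℚ.≤-reflexive (cong ℚ.∣_∣ (ℚ.+-inverseʳ q))) (ℚ.<⇒≤ 0<ε)

fromℕ : ℕ → ℝ
fromℕ n = fromℚ (+ n ℚ./ 1)

0ℝ 1ℝ : ℝ
0ℝ = fromℚ 0ℚ
1ℝ = fromℚ 1ℚ

_+_ : ℝ → ℝ → ℝ
(x + y) .seq    n     = seq x n ℚ.+ seq y n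
(x + y) .cauchy ε 0<ε with cauchy x (½ ℚ.* ε) (0<½*ε 0<ε) | cauchy y (½ ℚ.* ε) (0<½*ε 0<ε)
... | M , f | N , g = M ℕ.⊔ N , λ m n p q → ℚ.≤-trans
  (+-close (seq x m) (seq y m) (seq x n) (seq y n))
  (ℚ.≤-trans
    (ℚ.+-mono-≤ (f m n (ℕ.m⊔n≤o⇒m≤o M N p) (ℕ.m⊔n≤o⇒m≤o M N q))
                (g m n (ℕ.m⊔n≤o⇒n≤o M N p) (ℕ.m⊔n≤o⇒n≤o M N q)))
    (ℚ.≤-reflexive (halves ε)))

-_ : ℝ → ℝ
(- x) .seq    n     = ℚ.- seq x n
(- x) .cauchy ε 0<ε with cauchy x ε 0<ε
... | N , f = N , λ m n p q →
  ℚ.≤-trans (ℚ.≤-reflexive (neg-close (seq x m) (seq x n))) (f m n p q)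

_-_ : ℝ → ℝ → ℝ
x - y = x + - y

_⊔_ : ℝ → ℝ → ℝ
(x ⊔ y) .seq    n     = seq x n ℚ.⊔ seq y n
(x ⊔ y) .cauchy ε 0<ε with cauchy x ε 0<ε | cauchy y ε 0<ε
... | M , f | N , g = M ℕ.⊔ N , λ m n p q → ⊔-close (seq x m) (seq y m) (seq x n) (seq y n)
  (f m n (ℕ.m⊔n≤o⇒m≤o M N p) (ℕ.m⊔n≤o⇒m≤o M N q))
  (g m n (ℕ.m⊔n≤o⇒n≤o M N p) (ℕ.m⊔n≤o⇒n≤o M N q))

_⊓_ : ℝ → ℝ → ℝ
(x ⊓ y) .seq    n     = seq x n ℚ.⊓ seq y n
(x ⊓ y) .cauchy ε 0<ε with cauchy x ε 0<ε | cauchy y ε 0<ε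
... | M , f | N , g = M ℕ.⊔ N , λ m n p q → ⊓-close (seq x m) (seq y m) (seq x n) (seq y n)
  (f m n (ℕ.m⊔n≤o⇒m≤o M N p) (ℕ.m⊔n≤o⇒m≤o M N q))
  (g m n (ℕ.m⊔n≤o⇒n≤o M N p) (ℕ.m⊔n≤o⇒n≤o M N q))

∣_∣ : ℝ → ℝ
∣ x ∣ = x ⊔ - x

0<1 : 0ℚ ℚ.< 1ℚ
0<1 = ℚ.positive⁻¹ 1ℚ

bounded : ∀ x → ∃ λ K → 0ℚ ℚ.< K × Eventually λ n → ℚ.∣ seq x n ∣ ℚ.≤ K
bounded x with cauchy x 1ℚ 0<1
... | N , f = ℚ.∣ seq x N ∣ ℚ.+ 1ℚ , ℚ.+-mono-≤-< (0≤∣p∣ (seq x N)) 0<1 , N , λ n N≤n → begin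
  ℚ.∣ seq x n ∣                                  ≡⟨ cong ℚ.∣_∣ (solve 2 (λ a b → b := a :+ (b :- a)) refl (seq x N) (seq x n)) ⟩
  ℚ.∣ seq x N ℚ.+ (seq x n ℚ.- seq x N) ∣        ≤⟨ ℚ.∣p+q∣≤∣p∣+∣q∣ (seq x N) (seq x n ℚ.- seq x N) ⟩
  ℚ.∣ seq x N ∣ ℚ.+ ℚ.∣ seq x n ℚ.- seq x N ∣    ≤⟨ ℚ.+-monoʳ-≤ ℚ.∣ seq x N ∣ (f n N N≤n ℕ.≤-refl) ⟩
  ℚ.∣ seq x N ∣ ℚ.+ 1ℚ                           ∎
  where
  open ℚ.≤-Reasoning
  open +-*-Solver

divide : ∀ {K ε} → 0ℚ ℚ.< K → 0ℚ ℚ.< ε → ∃ λ δ → 0ℚ ℚ.< δ × K ℚ.* δ ≡ ε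
divide {K} {ε} 0<K 0<ε = δ , 0<δ , eq
  where
  instance
    K-pos : ℚ.Positive K
    K-pos = ℚ.positive 0<K
    K-nz : ℚ.NonZero K
    K-nz = ℚ.pos⇒nonZero K
    ε-pos : ℚ.Positive ε
    ε-pos = ℚ.positive 0<ε
    1/K-pos : ℚ.Positive (ℚ.1/ K)
    1/K-pos = ℚ.1/pos⇒pos K
  δ = ℚ.1/ K ℚ.* ε
  0<δ : 0ℚ ℚ.< δ
  0<δ = ℚ.positive⁻¹ δ {{ℚ.pos*pos⇒pos (ℚ.1/ K) ε}}
  eq : K ℚ.* δ ≡ ε
  eq = trans (sym (ℚ.*-assoc K (ℚ.1/ K) ε))
      (trans (cong (ℚ._* ε) (ℚ.*-inverseʳ K)) (ℚ.*-identityˡ ε))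

*-close : ∀ a b c d {A D δ η} → 0ℚ ℚ.≤ A → 0ℚ ℚ.≤ D → 0ℚ ℚ.≤ δ → 0ℚ ℚ.≤ η →
          ℚ.∣ a ∣ ℚ.≤ A → ℚ.∣ d ∣ ℚ.≤ D → ℚ.∣ b ℚ.- d ∣ ℚ.≤ δ → ℚ.∣ a ℚ.- c ∣ ℚ.≤ η →
          ℚ.∣ a ℚ.* b ℚ.- c ℚ.* d ∣ ℚ.≤ A ℚ.* δ ℚ.+ D ℚ.* η
*-close a b c d {A} {D} {δ} {η} 0≤A 0≤D 0≤δ 0≤η a≤A d≤D bd ac = begin
  ℚ.∣ a ℚ.* b ℚ.- c ℚ.* d ∣
    ≡⟨ cong ℚ.∣_∣ (solve 4 (λ a b c d → a :* b :- c :* d := a :* (b :- d) :+ d :* (a :- c)) refl a b c d) ⟩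
  ℚ.∣ a ℚ.* (b ℚ.- d) ℚ.+ d ℚ.* (a ℚ.- c) ∣
    ≤⟨ ℚ.∣p+q∣≤∣p∣+∣q∣ (a ℚ.* (b ℚ.- d)) (d ℚ.* (a ℚ.- c)) ⟩
  ℚ.∣ a ℚ.* (b ℚ.- d) ∣ ℚ.+ ℚ.∣ d ℚ.* (a ℚ.- c) ∣
    ≤⟨ ℚ.+-mono-≤
         (ℚ.≤-trans (ℚ.≤-reflexive (ℚ.∣p*q∣≡∣p∣*∣q∣ a (b ℚ.- d))) (*-mono (0≤∣p∣ a) 0≤δ a≤A bd))
         (ℚ.≤-trans (ℚ.≤-reflexive (ℚ.∣p*q∣≡∣p∣*∣q∣ d (a ℚ.- c))) (*-mono (0≤∣p∣ d) 0≤η d≤D ac)) ⟩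
  A ℚ.* δ ℚ.+ D ℚ.* η ∎
  where
  open ℚ.≤-Reasoning
  open +-*-Solver

_*_ : ℝ → ℝ → ℝ
(x * y) .seq    n     = seq x n ℚ.* seq y n
(x * y) .cauchy ε 0<ε =
  let A , 0<A , M₁ , boundA = bounded x
      D , 0<D , M₂ , boundD = bounded y
      δ , 0<δ , Aδ          = divide 0<A (0<½*ε 0<ε)
      η , 0<η , Dη          = divide 0<D (0<½*ε 0<ε)
      M₃ , closeY           = cauchy y δ 0<δ
      M₄ , closeX           = cauchy x η 0<η
      K = M₁ ℕ.⊔ M₂
      L = M₃ ℕ.⊔ M₄
  in K ℕ.⊔ L , λ m n p q →
    let Kp = ℕ.m⊔n≤o⇒m≤o K L p
        Kq = ℕ.m⊔n≤o⇒m≤o K L q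
        Lp = ℕ.m⊔n≤o⇒n≤o K L p
        Lq = ℕ.m⊔n≤o⇒n≤o K L q
    in ℚ.≤-trans
      (*-close (seq x m) (seq y m) (seq x n) (seq y n) (ℚ.<⇒≤ 0<A) (ℚ.<⇒≤ 0<D) (ℚ.<⇒≤ 0<δ) (ℚ.<⇒≤ 0<η)
        (boundA m (ℕ.m⊔n≤o⇒m≤o M₁ M₂ Kp))
        (boundD n (ℕ.m⊔n≤o⇒n≤o M₁ M₂ Kq))
        (closeY m n (ℕ.m⊔n≤o⇒m≤o M₃ M₄ Lp) (ℕ.m⊔n≤o⇒m≤o M₃ M₄ Lq))
        (closeX m n (ℕ.m⊔n≤o⇒n≤o M₃ M₄ Lp) (ℕ.m⊔n≤o⇒n≤o M₃ M₄ Lq)))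
      (ℚ.≤-reflexive (trans (cong₂ ℚ._+_ Aδ Dη) (halves ε)))

infixl 6 _-ᵥ_

_-ᵥ_ : ∀ {n} → Vector ℝ n → Vector ℝ n → Vector ℝ n
(x -ᵥ y) j = x j - y j

𝟎 : ∀ {n} → Vector ℝ n
𝟎 _ = 0ℝ

sumᵥ : ∀ {n} → Vector ℝ n → ℝ
sumᵥ {zero}  x = 0ℝ
sumᵥ {suc n} x = x zero + sumᵥ (tail x)

maxᵥ minᵥ : ∀ {d} → Vector ℝ (suc d) → ℝ
maxᵥ {zero}  x = x zero
maxᵥ {suc d} x = x zero ⊔ maxᵥ (tail x)
minᵥ {zero}  x = x zero
minᵥ {suc d} x = x zero ⊓ minᵥ (tail x)

infix 4 _∼_

_∼_ : ∀ {n} → Vector ℝ n → Vector ℝ n → Set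
x ∼ y = ∃ λ c → ∀ j → x j ≃ y j + c

0-close : ∀ {p ε} → p ≡ 0ℚ → 0ℚ ℚ.< ε → ℚ.∣ p ∣ ℚ.≤ ε
0-close refl 0<ε = ℚ.<⇒≤ 0<ε

∼-refl : ∀ {n} {x : Vector ℝ n} → x ∼ x
∼-refl {x = x} = 0ℝ , λ j ε 0<ε → 0 , λ k _ →
  0-close (solve 1 (λ a → a :- (a :+ con 0ℚ) := con 0ℚ) refl (seq (x j) k)) 0<ε
  where
  open +-*-Solver

∼-sym : ∀ {n} {x y : Vector ℝ n} → x ∼ y → y ∼ x
∼-sym {x = x} {y} (c , h) = - c , λ j ε 0<ε → let N , f = h j ε 0<ε in N , λ k N≤k →
  ℚ.≤-trans (ℚ.≤-reflexive (eq (seq (x j) k) (seq (y j) k) (seq c k))) (f k N≤k)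
  where
  open +-*-Solver
  eq : ∀ a b c → ℚ.∣ b ℚ.- (a ℚ.+ ℚ.- c) ∣ ≡ ℚ.∣ a ℚ.- (b ℚ.+ c) ∣
  eq a b c = trans
    (cong ℚ.∣_∣ (solve 3 (λ a b c → b :- (a :+ :- c) := :- (a :- (b :+ c))) refl a b c))
    (ℚ.∣-p∣≡∣p∣ (a ℚ.- (b ℚ.+ c)))

∼-trans : ∀ {n} {x y z : Vector ℝ n} → x ∼ y → y ∼ z → x ∼ z
∼-trans {x = x} {y} {z} (c , h) (d , h′) = d + c , λ j ε 0<ε →
  let M , f = h j (½ ℚ.* ε) (0<½*ε 0<ε) ; N , g = h′ j (½ ℚ.* ε) (0<½*ε 0<ε) in
  M ℕ.⊔ N , λ k p → ℚ.≤-trans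
    (eq (seq (x j) k) (seq (y j) k) (seq (z j) k) (seq c k) (seq d k))
    (ℚ.≤-trans
      (ℚ.+-mono-≤ (f k (ℕ.m⊔n≤o⇒m≤o M N p)) (g k (ℕ.m⊔n≤o⇒n≤o M N p)))
      (ℚ.≤-reflexive (halves ε)))
  where
  open +-*-Solver
  eq : ∀ a b e c d → ℚ.∣ a ℚ.- (e ℚ.+ (d ℚ.+ c)) ∣ ℚ.≤ ℚ.∣ a ℚ.- (b ℚ.+ c) ∣ ℚ.+ ℚ.∣ b ℚ.- (e ℚ.+ d) ∣
  eq a b e c d = ℚ.≤-trans
    (ℚ.≤-reflexive (cong ℚ.∣_∣ (solve 5 (λ a b e c d →
      a :- (e :+ (d :+ c)) := (a :- (b :+ c)) :+ (b :- (e :+ d))) refl a b e c d)))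
    (ℚ.∣p+q∣≤∣p∣+∣q∣ (a ℚ.- (b ℚ.+ c)) (b ℚ.- (e ℚ.+ d)))

-- ℝⁿ/ℝ𝟏: a point is given by a representative vector.
TorusSetoid : ℕ → Setoid 0ℓ 0ℓ
TorusSetoid n = record
  { Carrier       = Vector ℝ n
  ; _≈_           = _∼_
  ; isEquivalence = record
    { refl  = λ {x} → ∼-refl {x = x}
    ; sym   = λ {x} {y} → ∼-sym {x = x} {y}
    ; trans = λ {x} {y} {z} → ∼-trans {x = x} {y} {z}
    }
  }

Torus : ℕ → Set
Torus n = Setoid.Carrier (TorusSetoid n)

-- The isomorphism ℝⁿ/ℝ𝟏 ≅ ℝⁿ⁻¹ normalising the first coordinate to 0.
chart : ∀ {d} → Torus (suc d) → Vector ℝ d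
chart x j = x (suc j) - x zero

Bounded : ∀ {d} → Pred (Torus (suc d)) 0ℓ → Set
Bounded C = ∃ λ M → ∀ x → C x → ∀ j → ∣ chart x j ∣ ≤ M

UnitInterval : Pred ℝ 0ℓ
UnitInterval t = 0ℝ ≤ t × t ≤ 1ℝ

-- Throughout, t is the bias λ and the ambient dimension is n = suc d.
dtr : ∀ {d} → ℝ → Torus (suc d) → Torus (suc d) → ℝ
dtr {d} t x y =
    t * n * maxᵥ (x -ᵥ y)
  - (1ℝ - t) * n * minᵥ (x -ᵥ y)
  + (1ℝ - fromℕ 2 * t) * sumᵥ (x -ᵥ y)
  where n = fromℕ (suc d)

objective : ∀ {m d} → Vector (Torus (suc d)) m → Vector ℝ m → Vector ℝ m → Torus (suc d) → ℝ
objective V Λ w x = sumᵥ λ i → w i * dtr (Λ i) x (V i)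

TFW* : ∀ {m d} → Vector (Torus (suc d)) m → Vector ℝ m → Vector ℝ m → Pred (Torus (suc d)) 0ℓ
TFW* V Λ w x = ∀ y → objective V Λ w x ≤ objective V Λ w y

-- The sectors with apex v, written S_j^max(-v) and S_j^min(-v).
maxSector minSector : ∀ {n} → Vector ℝ n → Fin n → Pred (Vector ℝ n) 0ℓ
maxSector v j x = ∀ k → x k - v k ≤ x j - v j
minSector v j x = ∀ k → x j - v j ≤ x k - v k

-- The cones of the fan N_t are the faces of its maximal cones.  A face of a
-- polyhedral cone arises by turning some of its defining inequalities into
-- equalities; for the sector inequalities x_k ≤ x_j (resp. x_j ≤ x_k), k ∈ [n],
-- the subset A (resp. B) records those k for which equality is imposed.
-- Empty subsets give the maximal cones themselves.
data FanCone (n : ℕ) (t : ℝ) : Set where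
  maxMin  : 0ℝ < t → t < 1ℝ → (j k : Fin n) → j ≢ k → (A B : Subset n) → FanCone n t
  maxOnly : t ≃ 0ℝ → (j : Fin n) → (A : Subset n) → FanCone n t
  minOnly : t ≃ 1ℝ → (k : Fin n) → (B : Subset n) → FanCone n t

EqualOn : ∀ {n} → Subset n → Fin n → Pred (Vector ℝ n) 0ℓ
EqualOn A j x = ∀ a → a ∈ A → x a ≃ x j

⟦_⟧ : ∀ {n t} → FanCone n t → Pred (Vector ℝ n) 0ℓ
⟦ maxMin _ _ j k _ A B ⟧ x = (maxSector 𝟎 j x × minSector 𝟎 k x) × EqualOn A j x × EqualOn B k x
⟦ maxOnly _ j A ⟧        x = maxSector 𝟎 j x × EqualOn A j x
⟦ minOnly _ k B ⟧        x = minSector 𝟎 k x × EqualOn B k x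

infixr 6 _⊕_

_⊕_ : ∀ {n} → Vector ℝ n → Pred (Vector ℝ n) 0ℓ → Pred (Vector ℝ n) 0ℓ
(v ⊕ S) x = S (x -ᵥ v)

record Cell {m n} (V : Vector (Torus n) m) (Λ : Vector ℝ m) : Set where
  field
    cone : ∀ i → FanCone n (Λ i)

  points : Pred (Vector ℝ n) 0ℓ
  points x = ∀ i → (V i ⊕ ⟦ cone i ⟧) x

  field
    nonempty : ∃ points

{-# OPTIONS --safe #-}

-- Let J (resp. K) be the set of coordinates at which some cone of the cell
-- forces x − vᵢ to be maximal (resp. minimal).  If s ∈ J is witnessed by vᵢ,
-- the bias-1 distance to vᵢ has the subgradient n·e_s − 𝟏 at x⁰; if s ∈ K, the
-- bias-0 distance has the subgradient 𝟏 − n·e_s.  These add up to 0 when J or K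
-- is all of [n] (sum over s), or when J and K share some s.  Otherwise J and K
-- are disjoint and proper, and one of them is nonempty; a 0/1 vector χ which is
-- 1 on J and 0 on K and not constant is then a recession direction of the cell,
-- so the cell is unbounded.
module Submission where

open import Algebra.Bundles using (Ring)
import Algebra.Properties.Semiring.Sum as SemiringSum
open import Data.Bool using (Bool; true; false; not)
open import Data.Empty using (⊥; ⊥-elim)
open import Data.Fin using (Fin; zero; suc; _≟_)
import Data.Fin.Properties as Fin
open import Data.Fin.Subset using (_∈_)
open import Data.Fin.Subset.Properties using (_∈?_)
import Data.Integer as ℤ
import Data.Integer.Properties as ℤ
open import Data.Integer using (+_)
open import Data.Nat as ℕ using (ℕ; zero; suc)
import Data.Nat.Properties as ℕ
open import Data.Product using (∃; _×_; _,_; proj₁; proj₂)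
open import Data.Rational as ℚ using (ℚ; 0ℚ; 1ℚ; ½)
import Data.Rational.Properties as ℚ
import Data.Rational.Unnormalised as ℚᵘ
import Data.Rational.Unnormalised.Properties as ℚᵘ
open import Data.Rational.Solver using (module +-*-Solver)
open import Data.Sum using (_⊎_; inj₁; inj₂; map₂)
open import Data.Vec.Functional using (Vector; tail)
open import Function using (_∘_; const; id)
open import Relation.Binary.PropositionalEquality using (_≡_; _≢_; refl; sym; trans; cong; cong₂; subst; subst₂; module ≡-Reasoning)
open import Relation.Nullary using (¬_; Dec; yes; no; does)
open import Relation.Nullary.Decidable using (_⊎-dec_; _×-dec_; dec-true; dec-false)
open import Defs

open SemiringSum (Ring.semiring ℚ.+-*-ring) using (sum; sum-cong-≗; *-distribˡ-sum; *-distribʳ-sum; ∑-distrib-+; ∑-comm)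

-- The order on ℝ

infix 4 _≐_

-- Finer than `_≃_`: the representing sequences agree term by term. Algebraic identities between
-- reals then reduce to ring identities in ℚ, and `≤-resp-≐` carries them into inequalities.
_≐_ : ℝ → ℝ → Set
x ≐ y = ∀ k → seq x k ≡ seq y k

p≤p+ε : ∀ p {ε} → 0ℚ ℚ.< ε → p ℚ.≤ p ℚ.+ ε
p≤p+ε p {ε} 0<ε = subst (ℚ._≤ p ℚ.+ ε) (ℚ.+-identityʳ p) (ℚ.+-monoʳ-≤ p (ℚ.<⇒≤ 0<ε))

pointwise⇒≤ : ∀ {x y} → (∀ k → seq x k ℚ.≤ seq y k) → x ≤ y
pointwise⇒≤ {x} {y} h ε 0<ε = 0 , λ k _ → ℚ.≤-trans (h k) (p≤p+ε (seq y k) 0<ε)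

≐⇒≤ : ∀ {x y} → x ≐ y → x ≤ y
≐⇒≤ {x} {y} e = pointwise⇒≤ {x} {y} (ℚ.≤-reflexive ∘ e)

≐-sym : ∀ {x y} → x ≐ y → y ≐ x
≐-sym e k = sym (e k)

≤-trans : ∀ {x y z} → x ≤ y → y ≤ z → x ≤ z
≤-trans {x} {y} {z} h g ε 0<ε =
  let M , f = h (½ ℚ.* ε) (0<½*ε 0<ε) ; N , g′ = g (½ ℚ.* ε) (0<½*ε 0<ε) in
  M ℕ.⊔ N , λ k p → begin
    seq x k                                   ≤⟨ f k (ℕ.m⊔n≤o⇒m≤o M N p) ⟩
    seq y k ℚ.+ ½ ℚ.* ε                       ≤⟨ ℚ.+-monoˡ-≤ (½ ℚ.* ε) (g′ k (ℕ.m⊔n≤o⇒n≤o M N p)) ⟩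
    seq z k ℚ.+ ½ ℚ.* ε ℚ.+ ½ ℚ.* ε           ≡⟨ ℚ.+-assoc (seq z k) (½ ℚ.* ε) (½ ℚ.* ε) ⟩
    seq z k ℚ.+ (½ ℚ.* ε ℚ.+ ½ ℚ.* ε)         ≡⟨ cong (seq z k ℚ.+_) (halves ε) ⟩
    seq z k ℚ.+ ε                             ∎
  where open ℚ.≤-Reasoning

≤-resp-≐ : ∀ {x x′ y y′} → x ≐ x′ → y ≐ y′ → x ≤ y → x′ ≤ y′
≤-resp-≐ e f h ε 0<ε = let N , g = h ε 0<ε in N , λ k p →
  subst₂ ℚ._≤_ (e k) (cong (ℚ._+ ε) (f k)) (g k p)

+-mono-≤ : ∀ {x y z w} → x ≤ y → z ≤ w → x + z ≤ y + w
+-mono-≤ {x} {y} {z} {w} h g ε 0<ε =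
  let M , f = h (½ ℚ.* ε) (0<½*ε 0<ε) ; N , g′ = g (½ ℚ.* ε) (0<½*ε 0<ε) in
  M ℕ.⊔ N , λ k p → begin
    seq x k ℚ.+ seq z k                                     ≤⟨ ℚ.+-mono-≤ (f k (ℕ.m⊔n≤o⇒m≤o M N p)) (g′ k (ℕ.m⊔n≤o⇒n≤o M N p)) ⟩
    (seq y k ℚ.+ ½ ℚ.* ε) ℚ.+ (seq w k ℚ.+ ½ ℚ.* ε)         ≡⟨ solve 3 (λ y w e → (y :+ e) :+ (w :+ e) := y :+ w :+ (e :+ e)) refl (seq y k) (seq w k) (½ ℚ.* ε) ⟩
    seq y k ℚ.+ seq w k ℚ.+ (½ ℚ.* ε ℚ.+ ½ ℚ.* ε)           ≡⟨ cong (seq y k ℚ.+ seq w k ℚ.+_) (halves ε) ⟩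
    seq y k ℚ.+ seq w k ℚ.+ ε                               ∎
  where
  open ℚ.≤-Reasoning
  open +-*-Solver

neg-antimono-≤ : ∀ {x y} → x ≤ y → - y ≤ - x
neg-antimono-≤ {x} {y} h ε 0<ε = let N , f = h ε 0<ε in N , λ k p → begin
  ℚ.- seq y k                        ≡⟨ solve 2 (λ y e → :- y := :- (y :+ e) :+ e) refl (seq y k) ε ⟩
  ℚ.- (seq y k ℚ.+ ε) ℚ.+ ε          ≤⟨ ℚ.+-monoˡ-≤ ε (ℚ.neg-antimono-≤ (f k p)) ⟩
  ℚ.- seq x k ℚ.+ ε                  ∎
  where
  open ℚ.≤-Reasoning
  open +-*-Solver

*-monoʳ-≤ : ∀ {q x y} → 0ℚ ℚ.≤ q → x ≤ y → fromℚ q * x ≤ fromℚ q * y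
*-monoʳ-≤ {q} {x} {y} 0≤q h ε 0<ε =
  -- Dividing ε by q + 1 instead of q also covers q = 0.
  let δ , 0<δ , Kδ≡ε = divide {q ℚ.+ 1ℚ} (ℚ.+-mono-≤-< 0≤q 0<1) 0<ε ; N , f = h δ 0<δ in
  N , λ k p → begin
    q ℚ.* seq x k                             ≤⟨ ℚ.*-monoˡ-≤-nonNeg q {{ℚ.nonNegative 0≤q}} (f k p) ⟩
    q ℚ.* (seq y k ℚ.+ δ)                     ≡⟨ ℚ.*-distribˡ-+ q (seq y k) δ ⟩
    q ℚ.* seq y k ℚ.+ q ℚ.* δ                 ≤⟨ ℚ.+-monoʳ-≤ (q ℚ.* seq y k) (ℚ.*-monoʳ-≤-nonNeg δ {{ℚ.nonNegative (ℚ.<⇒≤ 0<δ)}} (p≤p+ε q 0<1)) ⟩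
    q ℚ.* seq y k ℚ.+ (q ℚ.+ 1ℚ) ℚ.* δ        ≡⟨ cong (q ℚ.* seq y k ℚ.+_) Kδ≡ε ⟩
    q ℚ.* seq y k ℚ.+ ε                       ∎
  where open ℚ.≤-Reasoning

≃⇒≤ : ∀ {x y} → x ≃ y → x ≤ y
≃⇒≤ {x} {y} h ε 0<ε = let N , f = h ε 0<ε in N , λ k p → close⇒≤ (seq x k) (seq y k) (f k p)

≃-sym : ∀ {x y} → x ≃ y → y ≃ x
≃-sym {x} {y} h ε 0<ε = let N , f = h ε 0<ε in N , λ k p → flip-close (seq x k) (seq y k) (f k p)

⊔-lub : ∀ {x y z} → x ≤ z → y ≤ z → x ⊔ y ≤ z
⊔-lub h g ε 0<ε = let M , f = h ε 0<ε ; N , g′ = g ε 0<ε in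
  M ℕ.⊔ N , λ k p → ℚ.⊔-lub (f k (ℕ.m⊔n≤o⇒m≤o M N p)) (g′ k (ℕ.m⊔n≤o⇒n≤o M N p))

⊓-glb : ∀ {x y z} → z ≤ x → z ≤ y → z ≤ x ⊓ y
⊓-glb {x} {y} {z} h g ε 0<ε = let M , f = h ε 0<ε ; N , g′ = g ε 0<ε in
  M ℕ.⊔ N , λ k p → ℚ.≤-trans
    (ℚ.⊓-glb (f k (ℕ.m⊔n≤o⇒m≤o M N p)) (g′ k (ℕ.m⊔n≤o⇒n≤o M N p)))
    (ℚ.≤-reflexive (sym (ℚ.mono-≤-distrib-⊓ (ℚ.+-monoˡ-≤ ε) (seq x k) (seq y k))))

maxᵥ-lub : ∀ {d z} (x : Vector ℝ (suc d)) → (∀ j → x j ≤ z) → maxᵥ x ≤ z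
maxᵥ-lub {zero}      x h = h zero
maxᵥ-lub {suc d} {z} x h = ⊔-lub {x zero} {maxᵥ (tail x)} {z} (h zero) (maxᵥ-lub {z = z} (tail x) (h ∘ suc))

minᵥ-glb : ∀ {d z} (x : Vector ℝ (suc d)) → (∀ j → z ≤ x j) → z ≤ minᵥ x
minᵥ-glb {zero}      x h = h zero
minᵥ-glb {suc d} {z} x h = ⊓-glb {x zero} {minᵥ (tail x)} {z} (h zero) (minᵥ-glb {z = z} (tail x) (h ∘ suc))

-- Kept at the level of terms, so that it chains with rational identities before `pointwise⇒≤` lifts
-- the result to ℝ.
x≤maxᵥ : ∀ {d} (x : Vector ℝ (suc d)) j k → seq (x j) k ℚ.≤ seq (maxᵥ x) k
x≤maxᵥ {zero}  x zero    k = ℚ.≤-refl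
x≤maxᵥ {suc d} x zero    k = ℚ.p≤p⊔q (seq (x zero) k) _
x≤maxᵥ {suc d} x (suc j) k = ℚ.≤-trans (x≤maxᵥ (tail x) j k) (ℚ.p≤q⊔p (seq (x zero) k) _)

minᵥ≤x : ∀ {d} (x : Vector ℝ (suc d)) j k → seq (minᵥ x) k ℚ.≤ seq (x j) k
minᵥ≤x {zero}  x zero    k = ℚ.≤-refl
minᵥ≤x {suc d} x zero    k = ℚ.p⊓q≤p (seq (x zero) k) _
minᵥ≤x {suc d} x (suc j) k = ℚ.≤-trans (ℚ.p⊓q≤q (seq (x zero) k) _) (minᵥ≤x (tail x) j k)

archimedean : ∀ x → (∀ T → 0ℚ ℚ.≤ T → fromℚ T ≤ x) → ⊥
archimedean x h =
  let K , 0<K , M , f = bounded x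
      0<K+K = ℚ.+-mono-< 0<K 0<K
      -- With |x| eventually at most K, taking T = 3K and tolerance K gives 3K ≤ x + K ≤ 2K.
      N , g = h (K ℚ.+ K ℚ.+ K) (ℚ.<⇒≤ (ℚ.+-mono-< 0<K+K 0<K)) K 0<K
      k = M ℕ.⊔ N
      K+K<K+K+K = subst (ℚ._< K ℚ.+ K ℚ.+ K) (ℚ.+-identityʳ (K ℚ.+ K)) (ℚ.+-monoʳ-< (K ℚ.+ K) 0<K)
  in ℚ.<-irrefl refl (begin-strict
    K ℚ.+ K              <⟨ K+K<K+K+K ⟩
    K ℚ.+ K ℚ.+ K        ≤⟨ g k (ℕ.m≤n⊔m M N) ⟩
    seq x k ℚ.+ K        ≤⟨ ℚ.+-monoˡ-≤ K (ℚ.≤-trans (p≤∣p∣ (seq x k)) (f k (ℕ.m≤m⊔n M N))) ⟩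
    K ℚ.+ K              ∎)
  where open ℚ.≤-Reasoning

-- Finite sums

sumᵥ-mono-≤ : ∀ {n} (x y : Vector ℝ n) → (∀ j → x j ≤ y j) → sumᵥ x ≤ sumᵥ y
sumᵥ-mono-≤ {zero}  x y h = ≐⇒≤ {0ℝ} {0ℝ} (λ _ → refl)
sumᵥ-mono-≤ {suc n} x y h =
  +-mono-≤ {x zero} {y zero} {sumᵥ (tail x)} {sumᵥ (tail y)} (h zero) (sumᵥ-mono-≤ (tail x) (tail y) (h ∘ suc))

seq-sumᵥ : ∀ {n} (x : Vector ℝ n) k → seq (sumᵥ x) k ≡ sum (λ j → seq (x j) k)
seq-sumᵥ {zero}  x k = refl
seq-sumᵥ {suc n} x k = cong (seq (x zero) k ℚ.+_) (seq-sumᵥ (tail x) k)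

sumᵥ-+ : ∀ {n} (x y : Vector ℝ n) → sumᵥ (λ j → x j + y j) ≐ sumᵥ x + sumᵥ y
sumᵥ-+ x y k = begin
  seq (sumᵥ (λ j → x j + y j)) k                            ≡⟨ seq-sumᵥ (λ j → x j + y j) k ⟩
  sum (λ j → seq (x j) k ℚ.+ seq (y j) k)                   ≡⟨ ∑-distrib-+ (λ j → seq (x j) k) (λ j → seq (y j) k) ⟩
  sum (λ j → seq (x j) k) ℚ.+ sum (λ j → seq (y j) k)       ≡⟨ cong₂ ℚ._+_ (seq-sumᵥ x k) (seq-sumᵥ y k) ⟨
  seq (sumᵥ x) k ℚ.+ seq (sumᵥ y) k                         ∎
  where open ≡-Reasoning

sumᵥ-cong : ∀ {n} (x y : Vector ℝ n) → (∀ j → x j ≐ y j) → sumᵥ x ≐ sumᵥ y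
sumᵥ-cong {zero}  x y e k = refl
sumᵥ-cong {suc n} x y e k = cong₂ ℚ._+_ (e zero k) (sumᵥ-cong (tail x) (tail y) (e ∘ suc) k)

telescope : ∀ x y v → y ℚ.- v ≡ (x ℚ.- v) ℚ.+ (y ℚ.- x)
telescope = solve 3 (λ x y v → y :- v := (x :- v) :+ (y :- x)) refl
  where open +-*-Solver

sumᵥ-telescope : ∀ {n} (x y v : Vector ℝ n) → sumᵥ (y -ᵥ v) ≐ sumᵥ (x -ᵥ v) + sumᵥ (y -ᵥ x)
sumᵥ-telescope x y v k = trans
  (sumᵥ-cong (y -ᵥ v) (λ j → (x -ᵥ v) j + (y -ᵥ x) j) (λ j i → telescope (seq (x j) i) (seq (y j) i) (seq (v j) i)) k)
  (sumᵥ-+ (x -ᵥ v) (y -ᵥ x) k)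

ι : ℕ → ℚ
ι n = + n ℚ./ 1

0≤ι : ∀ n → 0ℚ ℚ.≤ ι n
0≤ι n = ℚ.nonNegative⁻¹ (ι n) {{ℚ.normalize-nonNeg n 1}}

-- `ι` normalises its fraction and so does not compute on a variable n; the equation is checked on
-- unnormalised fractions of denominator 1.
ι-suc : ∀ n → ι (suc n) ≡ 1ℚ ℚ.+ ι n
ι-suc n = ℚ.toℚᵘ-injective (begin-equality
  ℚ.toℚᵘ (ι (suc n))                      ≃⟨ ℚ.toℚᵘ-fromℚᵘ (ℚᵘ.mkℚᵘ (+ suc n) 0) ⟩
  ℚᵘ.mkℚᵘ (+ suc n) 0                     ≃⟨ ℚᵘ.*≡* (cong (λ z → (+ 1 ℤ.+ z) ℤ.* + 1) (sym (ℤ.*-identityʳ (+ n)))) ⟩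
  ℚᵘ.1ℚᵘ ℚᵘ.+ ℚᵘ.mkℚᵘ (+ n) 0             ≃⟨ ℚᵘ.+-congʳ ℚᵘ.1ℚᵘ (ℚ.toℚᵘ-fromℚᵘ (ℚᵘ.mkℚᵘ (+ n) 0)) ⟨
  ℚᵘ.1ℚᵘ ℚᵘ.+ ℚ.toℚᵘ (ι n)                ≃⟨ ℚ.toℚᵘ-homo-+ 1ℚ (ι n) ⟨
  ℚ.toℚᵘ (1ℚ ℚ.+ ι n)                     ∎)
  where open ℚᵘ.≤-Reasoning

sum-const : ∀ n a → sum {n} (const a) ≡ ι n ℚ.* a
sum-const zero    a = sym (ℚ.*-zeroˡ a)
sum-const (suc n) a = begin
  a ℚ.+ sum {n} (const a)      ≡⟨ cong (a ℚ.+_) (sum-const n a) ⟩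
  a ℚ.+ ι n ℚ.* a              ≡⟨ solve 2 (λ a n → a :+ n :* a := (con 1ℚ :+ n) :* a) refl a (ι n) ⟩
  (1ℚ ℚ.+ ι n) ℚ.* a           ≡⟨ cong (ℚ._* a) (ι-suc n) ⟨
  ι (suc n) ℚ.* a              ∎
  where
  open ≡-Reasoning
  open +-*-Solver

-- This is the relation that the vectors n·e_j - 𝟏 add up to 0 over all j, paired with p.
sum-centred : ∀ {n} (p : Vector ℚ n) → sum (λ j → ι n ℚ.* p j ℚ.- sum p) ≡ 0ℚ
sum-centred {n} p = begin
  sum (λ j → ι n ℚ.* p j ℚ.- sum p)                         ≡⟨ ∑-distrib-+ (λ j → ι n ℚ.* p j) (const (ℚ.- sum p)) ⟩
  sum (λ j → ι n ℚ.* p j) ℚ.+ sum {n} (const (ℚ.- sum p))   ≡⟨ cong₂ ℚ._+_ (sym (*-distribˡ-sum (ι n) p)) (sum-const n (ℚ.- sum p)) ⟩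
  ι n ℚ.* sum p ℚ.+ ι n ℚ.* (ℚ.- sum p)                     ≡⟨ solve 2 (λ a s → a :* s :+ a :* (:- s) := con 0ℚ) refl (ι n) (sum p) ⟩
  0ℚ                                                        ∎
  where
  open ≡-Reasoning
  open +-*-Solver

-- Indicators, and weights that count repetitions

𝟙 : Bool → ℚ
𝟙 true  = 1ℚ
𝟙 false = 0ℚ

0≤𝟙 : ∀ b → 0ℚ ℚ.≤ 𝟙 b
0≤𝟙 true  = ℚ.<⇒≤ 0<1
0≤𝟙 false = ℚ.≤-refl

𝟙≤1 : ∀ b → 𝟙 b ℚ.≤ 1ℚ
𝟙≤1 true  = ℚ.≤-refl
𝟙≤1 false = ℚ.<⇒≤ 0<1

sum-0 : ∀ n → sum {n} (const 0ℚ) ≡ 0ℚ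
sum-0 n = trans (sum-const n 0ℚ) (ℚ.*-zeroʳ (ι n))

sum-nonneg : ∀ {n} (f : Vector ℚ n) → (∀ i → 0ℚ ℚ.≤ f i) → 0ℚ ℚ.≤ sum f
sum-nonneg {zero}  f h = ℚ.≤-refl
sum-nonneg {suc n} f h = ℚ.+-mono-≤ (h zero) (sum-nonneg (f ∘ suc) (h ∘ suc))

sum-δ : ∀ {m} (a : Fin m) (D : Vector ℚ m) → sum (λ i → 𝟙 (does (a ≟ i)) ℚ.* D i) ≡ D a
sum-δ {suc m} zero D = begin
  1ℚ ℚ.* D zero ℚ.+ sum (λ i → 0ℚ ℚ.* D (suc i))     ≡⟨ cong (1ℚ ℚ.* D zero ℚ.+_) (trans (sum-cong-≗ (λ i → ℚ.*-zeroˡ (D (suc i)))) (sum-0 m)) ⟩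
  1ℚ ℚ.* D zero ℚ.+ 0ℚ                               ≡⟨ ℚ.+-identityʳ _ ⟩
  1ℚ ℚ.* D zero                                      ≡⟨ ℚ.*-identityˡ _ ⟩
  D zero                                             ∎
  where open ≡-Reasoning
sum-δ {suc m} (suc a) D = begin
  0ℚ ℚ.* D zero ℚ.+ sum (λ i → 𝟙 (does (a ≟ i)) ℚ.* D (suc i))    ≡⟨ cong₂ ℚ._+_ (ℚ.*-zeroˡ (D zero)) (sum-δ a (D ∘ suc)) ⟩
  0ℚ ℚ.+ D (suc a)                                                ≡⟨ ℚ.+-identityˡ _ ⟩
  D (suc a)                                                       ∎
  where open ≡-Reasoning

multiplicity : ∀ {r m} → (Fin r → Fin m) → Fin m → ℚ
multiplicity c i = sum (λ l → 𝟙 (does (c l ≟ i)))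

-- After exchanging the two sums, the inner sum over i is a Kronecker delta at `c l`. This turns a
-- weighted objective into an unweighted sum over a list.
sum-multiplicity : ∀ {r m} (c : Fin r → Fin m) (D : Vector ℚ m) →
                   sum (λ i → multiplicity c i ℚ.* D i) ≡ sum (λ l → D (c l))
sum-multiplicity c D = begin
  sum (λ i → multiplicity c i ℚ.* D i)                         ≡⟨ sum-cong-≗ (λ i → *-distribʳ-sum (D i) (λ l → 𝟙 (does (c l ≟ i)))) ⟩
  sum (λ i → sum (λ l → 𝟙 (does (c l ≟ i)) ℚ.* D i))           ≡⟨ ∑-comm (λ i l → 𝟙 (does (c l ≟ i)) ℚ.* D i) ⟩
  sum (λ l → sum (λ i → 𝟙 (does (c l ≟ i)) ℚ.* D i))           ≡⟨ sum-cong-≗ (λ l → sum-δ (c l) D) ⟩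
  sum (λ l → D (c l))                                          ∎
  where open ≡-Reasoning

0≤multiplicity : ∀ {r m} (c : Fin r → Fin m) i → 0ℚ ℚ.≤ multiplicity c i
0≤multiplicity c i = sum-nonneg _ (λ l → 0≤𝟙 (does (c l ≟ i)))

1≤multiplicity : ∀ {r m} (c : Fin (suc r) → Fin m) → 1ℚ ℚ.≤ multiplicity c (c zero)
1≤multiplicity c = begin
  1ℚ                                                                ≡⟨ ℚ.+-identityʳ 1ℚ ⟨
  1ℚ ℚ.+ 0ℚ                                                         ≤⟨ ℚ.+-monoʳ-≤ 1ℚ (0≤multiplicity (c ∘ suc) (c zero)) ⟩
  1ℚ ℚ.+ multiplicity (c ∘ suc) (c zero)                            ≡⟨ cong (λ b → 𝟙 b ℚ.+ multiplicity (c ∘ suc) (c zero)) (dec-true (c zero ≟ c zero) refl) ⟨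
  multiplicity c (c zero)                                           ∎
  where open ℚ.≤-Reasoning

-- Subgradients of the distance

-- A zero coefficient makes both sides vanish, so x and y need not be comparable. At bias 0 or 1
-- this leaves only one of the two sector conditions to be supplied.
scale-≤ : ∀ {q n x y} → 0ℚ ℚ.≤ q → 0ℚ ℚ.≤ n → q ≡ 0ℚ ⊎ x ≤ y → fromℚ q * fromℚ n * x ≤ fromℚ q * fromℚ n * y
scale-≤ {q} {n} {x} {y} 0≤q 0≤n (inj₁ refl) =
  ≐⇒≤ {fromℚ q * fromℚ n * x} {fromℚ q * fromℚ n * y} (λ k → trans (vanish (seq x k)) (sym (vanish (seq y k))))
  where
  open +-*-Solver
  vanish : ∀ a → 0ℚ ℚ.* n ℚ.* a ≡ 0ℚ
  vanish = solve 2 (λ n a → con 0ℚ :* n :* a := con 0ℚ) refl n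
scale-≤ {q} {n} {x} {y} 0≤q 0≤n (inj₂ h) = *-monoʳ-≤ {q ℚ.* n} {x} {y} 0≤qn h
  where
  0≤qn : 0ℚ ℚ.≤ q ℚ.* n
  0≤qn = subst (ℚ._≤ q ℚ.* n) (ℚ.*-zeroʳ q) (ℚ.*-monoˡ-≤-nonNeg q {{ℚ.nonNegative 0≤q}} 0≤n)

-- The number 2q - 1: the maximum in `dtr` contributes q, the minimum -(1 - q).
slope : ℚ → ℚ
slope q = q ℚ.- (1ℚ ℚ.- q)

-- The pairing of n·e_s - 𝟏 with p.
centred : ∀ {n} → Vector ℝ n → Fin n → ℝ
centred {n} p s = fromℕ n * p s - sumᵥ p

-- The maximum of x - v is attained at s, and that entry changes by y_s - x_s on the way to y; hence
-- e_s is a subgradient of the maximum at x.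
maxᵥ-shift : ∀ {d} (x y v : Vector ℝ (suc d)) s → maxSector v s x → maxᵥ (x -ᵥ v) + (y s - x s) ≤ maxᵥ (y -ᵥ v)
maxᵥ-shift x y v s h = ≤-trans {maxᵥ (x -ᵥ v) + (y s - x s)} {(x s - v s) + (y s - x s)} {maxᵥ (y -ᵥ v)}
  (+-mono-≤ {maxᵥ (x -ᵥ v)} {x s - v s} {y s - x s} {y s - x s} (maxᵥ-lub {z = x s - v s} (x -ᵥ v) h) (≐⇒≤ {y s - x s} {y s - x s} (λ _ → refl)))
  (pointwise⇒≤ {(x s - v s) + (y s - x s)} {maxᵥ (y -ᵥ v)} (λ k → ℚ.≤-trans
    (ℚ.≤-reflexive (sym (telescope (seq (x s) k) (seq (y s) k) (seq (v s) k))))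
    (x≤maxᵥ (y -ᵥ v) s k)))

minᵥ-shift : ∀ {d} (x y v : Vector ℝ (suc d)) s → minSector v s x → minᵥ (y -ᵥ v) ≤ minᵥ (x -ᵥ v) + (y s - x s)
minᵥ-shift x y v s h = ≤-trans {minᵥ (y -ᵥ v)} {(x s - v s) + (y s - x s)} {minᵥ (x -ᵥ v) + (y s - x s)}
  (pointwise⇒≤ {minᵥ (y -ᵥ v)} {(x s - v s) + (y s - x s)} (λ k → ℚ.≤-trans (minᵥ≤x (y -ᵥ v) s k)
    (ℚ.≤-reflexive (telescope (seq (x s) k) (seq (y s) k) (seq (v s) k)))))
  (+-mono-≤ {x s - v s} {minᵥ (x -ᵥ v)} {y s - x s} {y s - x s} (minᵥ-glb {z = x s - v s} (x -ᵥ v) h) (≐⇒≤ {y s - x s} {y s - x s} (λ _ → refl)))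

-- Both extrema are estimated through the same coordinate s, and the sum term is linear. With p =
-- y_s - x_s and P the sum of y - x, the increments q·n·p - (1 - q)·n·p + (1 - 2q)·P combine to (2q
-- - 1)(n·p - P).
dtr-subgradient : ∀ {d} q (x y v : Vector ℝ (suc d)) s → 0ℚ ℚ.≤ q → 0ℚ ℚ.≤ 1ℚ ℚ.- q →
                  q ≡ 0ℚ ⊎ maxSector v s x → 1ℚ ℚ.- q ≡ 0ℚ ⊎ minSector v s x →
                  dtr (fromℚ q) x v + fromℚ (slope q) * centred (y -ᵥ x) s ≤ dtr (fromℚ q) y v
dtr-subgradient {d} q x y v s 0≤q 0≤q′ hmax hmin =
  ≤-resp-≐ {L} {dtr t x v + fromℚ (slope q) * centred (y -ᵥ x) s} {R} {dtr t y v}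
    (λ k → algebra q (ι (suc d)) (seq (maxᵥ (x -ᵥ v)) k) (seq (minᵥ (x -ᵥ v)) k) (seq (y s - x s) k)
                   (seq (sumᵥ (x -ᵥ v)) k) (seq (sumᵥ (y -ᵥ x)) k))
    (λ k → cong (λ z → seq (t * n * maxᵥ (y -ᵥ v) - (1ℝ - t) * n * minᵥ (y -ᵥ v)) k ℚ.+ (1ℚ ℚ.- ι 2 ℚ.* q) ℚ.* z)
                (sym (sumᵥ-telescope x y v k)))
    (+-mono-≤ {t * n * maxX - (1ℝ - t) * n * minX} {t * n * maxᵥ (y -ᵥ v) - (1ℝ - t) * n * minᵥ (y -ᵥ v)} {S} {S}
      (+-mono-≤ {t * n * maxX} {t * n * maxᵥ (y -ᵥ v)} { - ((1ℝ - t) * n * minX)} { - ((1ℝ - t) * n * minᵥ (y -ᵥ v))}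
        (scale-≤ {q} {ι (suc d)} {maxX} {maxᵥ (y -ᵥ v)} 0≤q (0≤ι (suc d)) (map₂ (maxᵥ-shift x y v s) hmax))
        (neg-antimono-≤ {(1ℝ - t) * n * minᵥ (y -ᵥ v)} {(1ℝ - t) * n * minX}
          (scale-≤ {1ℚ ℚ.- q} {ι (suc d)} {minᵥ (y -ᵥ v)} {minX} 0≤q′ (0≤ι (suc d)) (map₂ (minᵥ-shift x y v s) hmin))))
      (≐⇒≤ {S} {S} (λ _ → refl)))
  where
  open +-*-Solver
  t = fromℚ q
  n = fromℕ (suc d)
  maxX = maxᵥ (x -ᵥ v) + (y s - x s)
  minX = minᵥ (x -ᵥ v) + (y s - x s)
  -- The linear term at y, already split by telescoping through x. It stands on both sides, so only
  -- the two extrema are compared.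
  S = (1ℝ - fromℕ 2 * t) * (sumᵥ (x -ᵥ v) + sumᵥ (y -ᵥ x))
  L = t * n * maxX - (1ℝ - t) * n * minX + S
  R = t * n * maxᵥ (y -ᵥ v) - (1ℝ - t) * n * minᵥ (y -ᵥ v) + S
  algebra : ∀ q n M m p X P →
    q ℚ.* n ℚ.* (M ℚ.+ p) ℚ.- (1ℚ ℚ.- q) ℚ.* n ℚ.* (m ℚ.+ p) ℚ.+ (1ℚ ℚ.- ι 2 ℚ.* q) ℚ.* (X ℚ.+ P) ≡
    q ℚ.* n ℚ.* M ℚ.- (1ℚ ℚ.- q) ℚ.* n ℚ.* m ℚ.+ (1ℚ ℚ.- ι 2 ℚ.* q) ℚ.* X ℚ.+ slope q ℚ.* (n ℚ.* p ℚ.- P)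
  algebra = solve 7 (λ q n M m p X P →
    q :* n :* (M :+ p) :- (con 1ℚ :- q) :* n :* (m :+ p) :+ (con 1ℚ :- con (ι 2) :* q) :* (X :+ P) :=
    q :* n :* M :- (con 1ℚ :- q) :* n :* m :+ (con 1ℚ :- con (ι 2) :* q) :* X :+ (q :- (con 1ℚ :- q)) :* (n :* p :- P)) refl

1≰½ : ¬ 1ℚ ℚ.≤ ½
1≰½ (ℚ.*≤* (ℤ.+≤+ (ℕ.s≤s ())))

-- A list of pairs (vᵢ, s) whose subgradients cancel: the weight of vᵢ is the
-- number of times it occurs in the list.
minimiser : ∀ {m d r} (V : Vector (Torus (suc d)) m) (x : Torus (suc d))
            (c : Fin (suc r) → Fin m) (s : Fin (suc r) → Fin (suc d)) (b : Fin m → ℚ) →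
            (∀ i → 0ℚ ℚ.≤ b i) → (∀ i → 0ℚ ℚ.≤ 1ℚ ℚ.- b i) →
            (∀ l → b (c l) ≡ 0ℚ ⊎ maxSector (V (c l)) (s l) x) →
            (∀ l → 1ℚ ℚ.- b (c l) ≡ 0ℚ ⊎ minSector (V (c l)) (s l) x) →
            (∀ p → sum p ≡ 0ℚ → sum (λ l → slope (b (c l)) ℚ.* p (s l)) ≡ 0ℚ) →
            ∃ λ (w′ : Vector ℝ m) → ∃ λ (Λ′ : Vector ℝ m) →
              (∀ i → 0ℝ ≤ w′ i) × ¬ (∀ i → w′ i ≃ 0ℝ) ×
              (∀ i → UnitInterval (Λ′ i)) × TFW* V Λ′ w′ x
minimiser {m} {d} {r} V x c s b 0≤b 0≤1-b hmax hmin cancel =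
  w , Λ′ , (λ i → pointwise⇒≤ {0ℝ} {w i} (λ _ → 0≤multiplicity c i)) , w≢0 ,
  (λ i → pointwise⇒≤ {0ℝ} {Λ′ i} (λ _ → 0≤b i) , pointwise⇒≤ {Λ′ i} {1ℝ} (λ _ → b≤1 i)) , minimal
  where
  w Λ′ : Vector ℝ m
  w i = fromℚ (multiplicity c i)
  Λ′ i = fromℚ (b i)

  b≤1 : ∀ i → b i ℚ.≤ 1ℚ
  b≤1 i = begin
    b i                             ≡⟨ ℚ.+-identityʳ (b i) ⟨
    b i ℚ.+ 0ℚ                      ≤⟨ ℚ.+-monoʳ-≤ (b i) (0≤1-b i) ⟩
    b i ℚ.+ (1ℚ ℚ.- b i)            ≡⟨ solve 1 (λ b → b :+ (con 1ℚ :- b) := con 1ℚ) refl (b i) ⟩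
    1ℚ                              ∎
    where
    open ℚ.≤-Reasoning
    open +-*-Solver

  w≢0 : ¬ (∀ i → w i ≃ 0ℝ)
  -- `c zero` occurs in the list, so its weight is at least 1; equality with 0, tested at tolerance
  -- ½, would give 1 ≤ ½.
  w≢0 h = let N , f = ≃⇒≤ {w (c zero)} {0ℝ} (h (c zero)) ½ (ℚ.positive⁻¹ ½) in
    1≰½ (ℚ.≤-trans (1≤multiplicity c) (f N ℕ.≤-refl))

  distance : Torus (suc d) → Vector ℝ (suc r)
  distance y l = dtr (Λ′ (c l)) y (V (c l))

  objective≐ : ∀ y → objective V Λ′ w y ≐ sumᵥ (distance y)
  objective≐ y k = begin
    seq (objective V Λ′ w y) k                                           ≡⟨ seq-sumᵥ (λ i → w i * dtr (Λ′ i) y (V i)) k ⟩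
    sum (λ i → multiplicity c i ℚ.* seq (dtr (Λ′ i) y (V i)) k)          ≡⟨ sum-multiplicity c (λ i → seq (dtr (Λ′ i) y (V i)) k) ⟩
    sum (λ l → seq (distance y l) k)                                     ≡⟨ seq-sumᵥ (distance y) k ⟨
    seq (sumᵥ (distance y)) k                                            ∎
    where open ≡-Reasoning

  gradient : Torus (suc d) → Vector ℝ (suc r)
  gradient y l = fromℚ (slope (b (c l))) * centred (y -ᵥ x) (s l)

  gradient≐0 : ∀ y → sumᵥ (gradient y) ≐ 0ℝ
  -- `cancel` applies to families of sum 0. For each k the k-th terms of `centred (y -ᵥ x) j`, over
  -- all j, form one by `sum-centred`.
  gradient≐0 y k = trans (seq-sumᵥ (gradient y) k) (cancel (λ j → seq (centred (y -ᵥ x) j) k) (begin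
    sum (λ j → ι (suc d) ℚ.* p j ℚ.- seq (sumᵥ (y -ᵥ x)) k)     ≡⟨ sum-cong-≗ {suc d} {λ j → ι (suc d) ℚ.* p j ℚ.- seq (sumᵥ (y -ᵥ x)) k} {λ j → ι (suc d) ℚ.* p j ℚ.- sum p} (λ j → cong (λ z → ι (suc d) ℚ.* p j ℚ.- z) (seq-sumᵥ (y -ᵥ x) k)) ⟩
    sum (λ j → ι (suc d) ℚ.* p j ℚ.- sum p)                     ≡⟨ sum-centred p ⟩
    0ℚ                                                          ∎))
    where
    open ≡-Reasoning
    p : Vector ℚ (suc d)
    p j = seq (y j - x j) k

  minimal : TFW* V Λ′ w x
  -- The subgradient inequalities are added over the list; the gradient terms drop out, leaving the
  -- objective at x below the objective at y.
  minimal y = ≤-resp-≐ {sumᵥ (λ l → distance x l + gradient y l)} {objective V Λ′ w x} {sumᵥ (distance y)} {objective V Λ′ w y}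
    (λ k → trans (sumᵥ-+ (distance x) (gradient y) k)
          (trans (cong₂ ℚ._+_ (sym (objective≐ x k)) (gradient≐0 y k)) (ℚ.+-identityʳ (seq (objective V Λ′ w x) k))))
    (≐-sym {objective V Λ′ w y} {sumᵥ (distance y)} (objective≐ y))
    (sumᵥ-mono-≤ (λ l → distance x l + gradient y l) (distance y)
      (λ l → dtr-subgradient (b (c l)) x y (V (c l)) (s l) (0≤b (c l)) (0≤1-b (c l)) (hmax l) (hmin l)))

-- Coordinates singled out by a cone

-- These are read off the combinatorial data of the cone and not off a point in it, which makes them
-- decidable although the order on ℝ is not.
MaxAt MinAt : ∀ {n t} → FanCone n t → Fin n → Set
MaxAt (maxMin _ _ j k _ A B) s = s ≡ j ⊎ s ∈ A
MaxAt (maxOnly _ j A)        s = s ≡ j ⊎ s ∈ A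
MaxAt (minOnly _ k B)        s = ⊥
MinAt (maxMin _ _ j k _ A B) s = s ≡ k ⊎ s ∈ B
MinAt (maxOnly _ j A)        s = ⊥
MinAt (minOnly _ k B)        s = s ≡ k ⊎ s ∈ B

maxAt? : ∀ {n t} (σ : FanCone n t) s → Dec (MaxAt σ s)
maxAt? (maxMin _ _ j k _ A B) s = (s ≟ j) ⊎-dec (s ∈? A)
maxAt? (maxOnly _ j A)        s = (s ≟ j) ⊎-dec (s ∈? A)
maxAt? (minOnly _ k B)        s = no id

minAt? : ∀ {n t} (σ : FanCone n t) s → Dec (MinAt σ s)
minAt? (maxMin _ _ j k _ A B) s = (s ≟ k) ⊎-dec (s ∈? B)
minAt? (maxOnly _ j A)        s = no id
minAt? (minOnly _ k B)        s = (s ≟ k) ⊎-dec (s ∈? B)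

maxAt⊎minAt : ∀ {n t} (σ : FanCone n t) → ∃ (MaxAt σ) ⊎ ∃ (MinAt σ)
maxAt⊎minAt (maxMin _ _ j k _ A B) = inj₁ (j , inj₁ refl)
maxAt⊎minAt (maxOnly _ j A)        = inj₁ (j , inj₁ refl)
maxAt⊎minAt (minOnly _ k B)        = inj₂ (k , inj₁ refl)

x-0≐x : ∀ x → x - 0ℝ ≐ x
x-0≐x x k = ℚ.+-identityʳ (seq x k)

-- An index in A has the same entry of x - v as j, and so inherits the maximality of j.
face-max : ∀ {n} (x v : Vector ℝ n) j A s → maxSector 𝟎 j (x -ᵥ v) → EqualOn A j (x -ᵥ v) →
           s ≡ j ⊎ s ∈ A → maxSector v s x
face-max x v j A s h e s∈ k = at s∈
  where
  atⱼ : x k - v k ≤ x j - v j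
  atⱼ = ≤-resp-≐ {(x k - v k) - 0ℝ} {x k - v k} {(x j - v j) - 0ℝ} {x j - v j} (x-0≐x (x k - v k)) (x-0≐x (x j - v j)) (h k)
  at : s ≡ j ⊎ s ∈ A → x k - v k ≤ x s - v s
  at (inj₁ refl) = atⱼ
  at (inj₂ s∈A)  = ≤-trans {x k - v k} {x j - v j} {x s - v s} atⱼ
    (≃⇒≤ {x j - v j} {x s - v s} (≃-sym {x s - v s} {x j - v j} (e s s∈A)))

face-min : ∀ {n} (x v : Vector ℝ n) j A s → minSector 𝟎 j (x -ᵥ v) → EqualOn A j (x -ᵥ v) →
           s ≡ j ⊎ s ∈ A → minSector v s x
face-min x v j A s h e s∈ k = at s∈
  where
  atⱼ : x j - v j ≤ x k - v k
  atⱼ = ≤-resp-≐ {(x j - v j) - 0ℝ} {x j - v j} {(x k - v k) - 0ℝ} {x k - v k} (x-0≐x (x j - v j)) (x-0≐x (x k - v k)) (h k)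
  at : s ≡ j ⊎ s ∈ A → x s - v s ≤ x k - v k
  at (inj₁ refl) = atⱼ
  at (inj₂ s∈A)  = ≤-trans {x s - v s} {x j - v j} {x k - v k} (≃⇒≤ {x s - v s} {x j - v j} (e s s∈A)) atⱼ

cone-max : ∀ {n t} (σ : FanCone n t) (x v : Vector ℝ n) → ⟦ σ ⟧ (x -ᵥ v) → ∀ s → MaxAt σ s → maxSector v s x
cone-max (maxMin _ _ j k _ A B) x v ((h , _) , e , _) s = face-max x v j A s h e
cone-max (maxOnly _ j A)        x v (h , e)           s = face-max x v j A s h e

cone-min : ∀ {n t} (σ : FanCone n t) (x v : Vector ℝ n) → ⟦ σ ⟧ (x -ᵥ v) → ∀ s → MinAt σ s → minSector v s x
cone-min (maxMin _ _ j k _ A B) x v ((_ , h) , _ , e) s = face-min x v k B s h e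
cone-min (minOnly _ k B)        x v (h , e)           s = face-min x v k B s h e

-- Recession directions

shift : ∀ {n} → ℚ → (Fin n → Bool) → Vector ℝ n → Vector ℝ n
shift T χ x j = x j + fromℚ (T ℚ.* 𝟙 (χ j))

module _ {n} (χ : Fin n → Bool) (x v : Vector ℝ n) {T : ℚ} (0≤T : 0ℚ ℚ.≤ T) where

  -- The smaller entry is raised by no more than the larger one, since T ≥ 0.
  shift-≤ : ∀ j k → 𝟙 (χ j) ℚ.≤ 𝟙 (χ k) → (x j - v j) - 0ℝ ≤ (x k - v k) - 0ℝ →
            (shift T χ x j - v j) - 0ℝ ≤ (shift T χ x k - v k) - 0ℝ
  shift-≤ j k χ≤ h = ≤-resp-≐
    {((x j - v j) - 0ℝ) + fromℚ (T ℚ.* 𝟙 (χ j))} {(shift T χ x j - v j) - 0ℝ}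
    {((x k - v k) - 0ℝ) + fromℚ (T ℚ.* 𝟙 (χ k))} {(shift T χ x k - v k) - 0ℝ}
    (λ i → rearrange (seq (x j) i) (seq (v j) i) (T ℚ.* 𝟙 (χ j)))
    (λ i → rearrange (seq (x k) i) (seq (v k) i) (T ℚ.* 𝟙 (χ k)))
    (+-mono-≤ {(x j - v j) - 0ℝ} {(x k - v k) - 0ℝ} {fromℚ (T ℚ.* 𝟙 (χ j))} {fromℚ (T ℚ.* 𝟙 (χ k))} h
      (pointwise⇒≤ {fromℚ (T ℚ.* 𝟙 (χ j))} {fromℚ (T ℚ.* 𝟙 (χ k))}
        (λ _ → ℚ.*-monoˡ-≤-nonNeg T {{ℚ.nonNegative 0≤T}} χ≤)))
    where
    open +-*-Solver
    rearrange : ∀ a b c → ((a ℚ.- b) ℚ.- 0ℚ) ℚ.+ c ≡ ((a ℚ.+ c) ℚ.- b) ℚ.- 0ℚ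
    rearrange = solve 3 (λ a b c → ((a :- b) :- con 0ℚ) :+ c := ((a :+ c) :- b) :- con 0ℚ) refl

  shift-≃ : ∀ j k → χ j ≡ χ k → x j - v j ≃ x k - v k → shift T χ x j - v j ≃ shift T χ x k - v k
  shift-≃ j k χ≡ h ε 0<ε = let N , f = h ε 0<ε in N , λ i N≤i → ℚ.≤-trans
    (ℚ.≤-reflexive (cong ℚ.∣_∣ (trans
      (cong (λ z → (seq (x j) i ℚ.+ T ℚ.* 𝟙 z) ℚ.- seq (v j) i ℚ.- (seq (x k) i ℚ.+ T ℚ.* 𝟙 (χ k) ℚ.- seq (v k) i)) χ≡)
      (rearrange (seq (x j) i) (seq (v j) i) (seq (x k) i) (seq (v k) i) (T ℚ.* 𝟙 (χ k))))))
    (f i N≤i)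
    where
    open +-*-Solver
    rearrange : ∀ a b c d e → ((a ℚ.+ e) ℚ.- b) ℚ.- ((c ℚ.+ e) ℚ.- d) ≡ (a ℚ.- b) ℚ.- (c ℚ.- d)
    rearrange = solve 5 (λ a b c d e → ((a :+ e) :- b) :- ((c :+ e) :- d) := (a :- b) :- (c :- d)) refl

  shift-maxSector : ∀ j → χ j ≡ true → maxSector 𝟎 j (x -ᵥ v) → maxSector 𝟎 j (shift T χ x -ᵥ v)
  shift-maxSector j χj h k = shift-≤ k j (subst (λ b → 𝟙 (χ k) ℚ.≤ 𝟙 b) (sym χj) (𝟙≤1 (χ k))) (h k)

  shift-minSector : ∀ j → χ j ≡ false → minSector 𝟎 j (x -ᵥ v) → minSector 𝟎 j (shift T χ x -ᵥ v)
  shift-minSector j χj h k = shift-≤ j k (subst (λ b → 𝟙 b ℚ.≤ 𝟙 (χ k)) (sym χj) (0≤𝟙 (χ k))) (h k)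

  shift-EqualOn : ∀ b j A → (∀ s → s ≡ j ⊎ s ∈ A → χ s ≡ b) → EqualOn A j (x -ᵥ v) → EqualOn A j (shift T χ x -ᵥ v)
  shift-EqualOn b j A h e s s∈A = shift-≃ s j (trans (h s (inj₂ s∈A)) (sym (h j (inj₁ refl)))) (e s s∈A)

  -- Maximal coordinates move by T, the largest displacement, and minimal ones by 0, the smallest;
  -- two coordinates tied by an imposed equality move together. So every constraint of the cone
  -- survives.
  shift-cone : ∀ {t} (σ : FanCone n t) → (∀ s → MaxAt σ s → χ s ≡ true) → (∀ s → MinAt σ s → χ s ≡ false) →
               ⟦ σ ⟧ (x -ᵥ v) → ⟦ σ ⟧ (shift T χ x -ᵥ v)
  shift-cone (maxMin _ _ j k _ A B) hJ hK ((hj , hk) , eA , eB) =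
    (shift-maxSector j (hJ j (inj₁ refl)) hj , shift-minSector k (hK k (inj₁ refl)) hk) ,
    shift-EqualOn true j A hJ eA , shift-EqualOn false k B hK eB
  shift-cone (maxOnly _ j A) hJ hK (hj , eA) = shift-maxSector j (hJ j (inj₁ refl)) hj , shift-EqualOn true j A hJ eA
  shift-cone (minOnly _ k B) hJ hK (hk , eB) = shift-minSector k (hK k (inj₁ refl)) hk , shift-EqualOn false k B hK eB

shift-unbounded : ∀ {d} (P : Vector ℝ (suc d) → Set) (x : Vector ℝ (suc d)) (χ : Fin (suc d) → Bool) u u′ →
                  χ u ≡ true → χ u′ ≡ false → (∀ T → 0ℚ ℚ.≤ T → P (shift T χ x)) → ¬ Bounded P
-- `chart` measures against coordinate `zero`, so the index to follow is whichever of u, u′ has a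
-- value of χ other than `χ zero`: its chart entry changes by T in absolute value.
shift-unbounded {d} P x χ u u′ χu χu′ inP (M , bound) = split (χ zero) refl u u′ χu χu′
  where
  open +-*-Solver

  ≤∣·∣ : ∀ z → z ≤ ∣ z ∣
  ≤∣·∣ z = pointwise⇒≤ {z} {∣ z ∣} (λ k → ℚ.p≤p⊔q (seq z k) _)

  -≤∣·∣ : ∀ z → - z ≤ ∣ z ∣
  -≤∣·∣ z = pointwise⇒≤ { - z} {∣ z ∣} (λ k → ℚ.p≤q⊔p (seq z k) _)

  -- Isolates T: the bound M + y is the same for every T, contradicting `archimedean`.
  move : ∀ T z y → (∀ k → seq z k ≡ T ℚ.- seq y k) → z ≤ M → fromℚ T ≤ M + y
  move T z y e h = ≤-resp-≐ {z + y} {fromℚ T} {M + y} {M + y}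
    (λ k → trans (cong (ℚ._+ seq y k) (e k)) (solve 2 (λ T y → T :- y :+ y := T) refl T (seq y k)))
    (λ _ → refl)
    (+-mono-≤ {z} {M} {y} {y} h (≐⇒≤ {y} {y} (λ _ → refl)))

  split : ∀ b → χ zero ≡ b → ∀ u u′ → χ u ≡ true → χ u′ ≡ false → ⊥
  split true χ0 u zero χu χu′ with () ← trans (sym χ0) χu′
  split true χ0 u (suc j) χu χu′ = archimedean (M + (x (suc j) - x zero)) λ T 0≤T →
    let z = chart (shift T χ x) j in
    move T (- z) (x (suc j) - x zero)
      (λ k → trans
        (cong₂ (λ a b → ℚ.- ((seq (x (suc j)) k ℚ.+ T ℚ.* 𝟙 a) ℚ.- (seq (x zero) k ℚ.+ T ℚ.* 𝟙 b))) χu′ χ0)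
        (solve 3 (λ a b T → :- ((a :+ T :* con 0ℚ) :- (b :+ T :* con 1ℚ)) := T :- (a :- b)) refl (seq (x (suc j)) k) (seq (x zero) k) T))
      (≤-trans { - z} {∣ z ∣} {M} (-≤∣·∣ z) (bound (shift T χ x) (inP T 0≤T) j))
  split false χ0 zero u′ χu χu′ with () ← trans (sym χ0) χu
  split false χ0 (suc j) u′ χu χu′ = archimedean (M + (x zero - x (suc j))) λ T 0≤T →
    let z = chart (shift T χ x) j in
    move T z (x zero - x (suc j))
      (λ k → trans
        (cong₂ (λ a b → (seq (x (suc j)) k ℚ.+ T ℚ.* 𝟙 a) ℚ.- (seq (x zero) k ℚ.+ T ℚ.* 𝟙 b)) χu χ0)
        (solve 3 (λ a b T → (a :+ T :* con 1ℚ) :- (b :+ T :* con 0ℚ) := T :- (b :- a)) refl (seq (x (suc j)) k) (seq (x zero) k) T))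
      (≤-trans {z} {∣ z ∣} {M} (≤∣·∣ z) (bound (shift T χ x) (inP T 0≤T) j))

-- Cancelling subgradients, or an unbounded cell

0≤½ : 0ℚ ℚ.≤ ½
0≤½ = ℚ.<⇒≤ (ℚ.positive⁻¹ ½)

theorem4 : ∀ {m d : ℕ} → 1 ℕ.≤ m →
    (V : Vector (Torus (suc d)) m) (Λ : Vector ℝ m) → (∀ i → UnitInterval (Λ i)) →
    (C : Cell V Λ) → Bounded (Cell.points C) →
    (x⁰ : Torus (suc d)) → Cell.points C x⁰ →
    ∃ λ (w′ : Vector ℝ m) → ∃ λ (Λ′ : Vector ℝ m) →
    (∀ i → 0ℝ ≤ w′ i) × ¬ (∀ i → w′ i ≃ 0ℝ) ×
    (∀ i → UnitInterval (Λ′ i)) × TFW* V Λ′ w′ x⁰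
theorem4 {suc m} {d} _ V Λ _ C C-bounded x⁰ x⁰∈C = cases (Fin.all? J?) (Fin.all? K?) (Fin.any? (λ s → J? s ×-dec K? s))
  where
  open Cell C using (cone; points)
  open +-*-Solver

  J K : Fin (suc d) → Set
  J s = ∃ λ i → MaxAt (cone i) s
  K s = ∃ λ i → MinAt (cone i) s

  J? : ∀ s → Dec (J s)
  J? s = Fin.any? (λ i → maxAt? (cone i) s)

  K? : ∀ s → Dec (K s)
  K? s = Fin.any? (λ i → minAt? (cone i) s)

  J-max : ∀ i s → MaxAt (cone i) s → maxSector (V i) s x⁰
  J-max i s = cone-max (cone i) x⁰ (V i) (x⁰∈C i) s

  K-min : ∀ i s → MinAt (cone i) s → minSector (V i) s x⁰
  K-min i s = cone-min (cone i) x⁰ (V i) (x⁰∈C i) s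

  Goal : Set
  Goal = ∃ λ (w′ : Vector ℝ (suc m)) → ∃ λ (Λ′ : Vector ℝ (suc m)) →
    (∀ i → 0ℝ ≤ w′ i) × ¬ (∀ i → w′ i ≃ 0ℝ) ×
    (∀ i → UnitInterval (Λ′ i)) × TFW* V Λ′ w′ x⁰

  all-max : (∀ s → J s) → Goal
  -- One list entry per coordinate s. Bias 1 everywhere removes the minimum condition, and the
  -- constant slope factors out of a sum that is 0.
  all-max h = minimiser V x⁰ (λ s → proj₁ (h s)) id (const 1ℚ)
    (λ _ → ℚ.<⇒≤ 0<1) (λ _ → ℚ.≤-refl) (λ s → inj₂ (J-max (proj₁ (h s)) s (proj₂ (h s)))) (λ _ → inj₁ refl)
    (λ p ∑p≡0 → trans (sym (*-distribˡ-sum (slope 1ℚ) p)) (trans (cong (slope 1ℚ ℚ.*_) ∑p≡0) (ℚ.*-zeroʳ (slope 1ℚ))))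

  all-min : (∀ s → K s) → Goal
  all-min h = minimiser V x⁰ (λ s → proj₁ (h s)) id (const 0ℚ)
    (λ _ → ℚ.≤-refl) (λ _ → ℚ.<⇒≤ 0<1) (λ _ → inj₁ refl) (λ s → inj₂ (K-min (proj₁ (h s)) s (proj₂ (h s))))
    (λ p ∑p≡0 → trans (sym (*-distribˡ-sum (slope 0ℚ) p)) (trans (cong (slope 0ℚ ℚ.*_) ∑p≡0) (ℚ.*-zeroʳ (slope 0ℚ))))

  coincident : ∀ s i → MaxAt (cone i) s → MinAt (cone i) s → Goal
  -- A single vᵢ cannot carry bias 1 and bias 0 at once, so bias ½ is used, where the slope is 0.
  -- Here x⁰ - vᵢ is constant, so x⁰ and vᵢ are the same point of the torus.
  coincident s i s∈J s∈K = minimiser {r = 0} V x⁰ (const i) (const s) (const ½)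
    (λ _ → 0≤½) (λ _ → 0≤½) (λ _ → inj₂ (J-max i s s∈J)) (λ _ → inj₂ (K-min i s s∈K))
    (λ p _ → solve 1 (λ a → con 0ℚ :* a :+ con 0ℚ := con 0ℚ) refl (p s))

  distinct : ∀ s i i′ → i ≢ i′ → MaxAt (cone i) s → MinAt (cone i′) s → Goal
  -- The biases are 1 at i and 0 at i′, giving slopes 1 and -1 at the same coordinate s.
  distinct s i i′ i≢i′ s∈J s∈K = minimiser {r = 1} V x⁰ c (const s) b
    (λ l → 0≤𝟙 (does (i ≟ l))) (λ l → 0≤1-𝟙 (does (i ≟ l)))
    (λ { zero → inj₂ (J-max i s s∈J) ; (suc zero) → inj₁ bi′ })
    (λ { zero → inj₁ (cong (λ z → 1ℚ ℚ.- z) bi) ; (suc zero) → inj₂ (K-min i′ s s∈K) })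
    (λ p _ → trans (cong₂ (λ y z → slope y ℚ.* p s ℚ.+ (slope z ℚ.* p s ℚ.+ 0ℚ)) bi bi′)
      (solve 1 (λ a → con 1ℚ :* a :+ (con (ℚ.- 1ℚ) :* a :+ con 0ℚ) := con 0ℚ) refl (p s)))
    where
    c : Fin 2 → Fin (suc m)
    c zero       = i
    c (suc zero) = i′
    b : Fin (suc m) → ℚ
    b l = 𝟙 (does (i ≟ l))
    bi : b i ≡ 1ℚ
    bi = cong 𝟙 (dec-true (i ≟ i) refl)
    bi′ : b i′ ≡ 0ℚ
    bi′ = cong 𝟙 (dec-false (i ≟ i′) i≢i′)
    0≤1-𝟙 : ∀ z → 0ℚ ℚ.≤ 1ℚ ℚ.- 𝟙 z
    0≤1-𝟙 true  = ℚ.≤-refl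
    0≤1-𝟙 false = ℚ.<⇒≤ 0<1

  common : ∀ s i i′ → MaxAt (cone i) s → MinAt (cone i′) s → Dec (i ≡ i′) → Goal
  common s i .i s∈J s∈K (yes refl) = coincident s i s∈J s∈K
  common s i i′ s∈J s∈K (no i≢i′)  = distinct s i i′ i≢i′ s∈J s∈K

  escape : (χ : Fin (suc d) → Bool) → (∀ s → J s → χ s ≡ true) → (∀ s → K s → χ s ≡ false) →
           ∀ u u′ → χ u ≡ true → χ u′ ≡ false → ⊥
  escape χ hJ hK u u′ χu χu′ = shift-unbounded points x⁰ χ u u′ χu χu′
    (λ T 0≤T i → shift-cone χ x⁰ (V i) 0≤T (cone i) (λ s → hJ s ∘ (i ,_)) (λ s → hK s ∘ (i ,_)) (x⁰∈C i))
    C-bounded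

  cases : Dec (∀ s → J s) → Dec (∀ s → K s) → Dec (∃ λ s → J s × K s) → Goal
  cases (yes h) _ _ = all-max h
  cases (no _) (yes h) _ = all-min h
  cases (no _) (no _) (yes (s , (i , s∈J) , i′ , s∈K)) = common s i i′ s∈J s∈K (i ≟ i′)
  -- Since m ≥ 1 there is a cone `cone zero`, which puts a coordinate into J or into K.
  cases (no J≢) (no K≢) (no J∩K) = ⊥-elim (contra (maxAt⊎minAt (cone zero)))
    where
    contra : ∃ (MaxAt (cone zero)) ⊎ ∃ (MinAt (cone zero)) → ⊥
    -- J is nonempty and proper, so its indicator is not constant; it vanishes on K by disjointness.
    contra (inj₁ (u , u∈J)) with Fin.¬∀⟶∃¬ (suc d) J J? J≢
    ... | u′ , u′∉J = escape (does ∘ J?) (λ s → dec-true (J? s)) (λ s s∈K → dec-false (J? s) (λ s∈J → J∩K (s , s∈J , s∈K)))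
      u u′ (dec-true (J? u) (zero , u∈J)) (dec-false (J? u′) u′∉J)
    -- Here K is the set known to be nonempty, so χ is the indicator of its complement, which
    -- contains J.
    contra (inj₂ (u′ , u′∈K)) with Fin.¬∀⟶∃¬ (suc d) K K? K≢
    ... | u , u∉K = escape (not ∘ does ∘ K?)
      (λ s s∈J → cong not (dec-false (K? s) (λ s∈K → J∩K (s , s∈J , s∈K)))) (λ s s∈K → cong not (dec-true (K? s) s∈K))
      u u′ (cong not (dec-false (K? u) u∉K)) (cong not (dec-true (K? u′) (zero , u′∈K)))
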